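{- If a graph $G$ does not contain $K_{2,3}$ as a minor, then $G$ does not contain an agile set of size $5$.
   Context: Graphs are simple and undirected. A pair $(X_1,X_2)$ of disjoint vertex sets of a graph $G$ is independent if there are two disjoint trees $T_1,T_2$ in $G$ such that $X_1\subseteq V(T_1)$ and $X_2\subseteq V(T_2)$ (partition classes may be empty, and if $X_i=\emptyset$ the corresponding $T_i$ may be taken empty). A set $X\subseteq V(G)$ is agile (in $G$) if for every partition $X=X_1\,\dot\cup\,X_2$ the pair $(X_1,X_2)$ is independent. -}

module Defs where

open import Data.Empty using () renaming (⊥ to False)
open import Data.Fin using (Fin; zero; suc; inject₁; fromℕ)
open import Data.Nat using (ℕ; _+_)
open import Data.Product using (_×_; _,_; ∃-syntax; Σ-syntax)
open import Data.Sum using (_⊎_; inj₁; inj₂)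
open import Data.Unit using (⊤)
open import Function.Definitions using (Injective)
open import Level using (0ℓ)
open import Relation.Binary.Construct.Closure.ReflexiveTransitive using (Star)
open import Relation.Binary.Core using (Rel)
open import Relation.Binary.Definitions using (Symmetric)
open import Relation.Binary.PropositionalEquality using (_≡_; _≢_)
open import Relation.Nullary using (¬_)
open import Relation.Unary
  using (Pred; _∈_; _⊆_; _≐_; _∪_; _⊥_; Empty; Satisfiable)

-- Simple undirected graphs, finite or infinite.  Only the inhabitation of
-- Adj u v matters, so there are no parallel edges.
record Graph : Set₁ where
  field
    V         : Set
    Adj       : Rel V 0ℓ
    symmetric : Symmetric Adj
    loopless  : ∀ v → ¬ Adj v v

open Graph public using (V)

VertexSet : Graph → Set₁
VertexSet G = Pred (V G) 0ℓ

-- Possibly empty, and not necessarily induced.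
record Subgraph (G : Graph) : Set₁ where
  open Graph G using (Adj)
  field
    VS        : VertexSet G
    ES        : Rel (V G) 0ℓ
    symmetric : Symmetric ES
    edge⇒adj  : ∀ {u v} → ES u v → Adj u v
    edge⇒∈    : ∀ {u v} → ES u v → u ∈ VS

open Subgraph public using (VS; ES)

induced : (G : Graph) → VertexSet G → Subgraph G
induced G U = record
  { VS        = U
  ; ES        = λ u v → u ∈ U × v ∈ U × Adj u v
  ; symmetric = λ (u∈U , v∈U , uv) → v∈U , u∈U , symmetric uv
  ; edge⇒adj  = λ (_ , _ , uv) → uv
  ; edge⇒∈    = λ (u∈U , _) → u∈U
  }
  where
  open Graph G

module _ {G : Graph} where

  -- The empty graph is not connected; in particular trees are nonempty.
  Connected : Subgraph G → Set
  Connected H =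
    Satisfiable (VS H) × (∀ {u v} → u ∈ VS H → v ∈ VS H → Star (ES H) u v)

  -- A cycle of length 3 + k, given by its vertices in cyclic order.
  record Cycle (H : Subgraph G) : Set where
    field
      k        : ℕ
      vertex   : Fin (3 + k) → V G
      distinct : Injective _≡_ _≡_ vertex
      step     : ∀ (i : Fin (2 + k)) →
                 ES H (vertex (inject₁ i)) (vertex (suc i))
      close    : ES H (vertex (fromℕ (2 + k))) (vertex zero)

  IsTree : Subgraph G → Set
  IsTree T = Connected T × ¬ Cycle T

-- T is a tree containing X, where the empty graph is also permitted for X = ∅.
TreeCovering : (G : Graph) → VertexSet G → Subgraph G → Set
TreeCovering G X T =
  (IsTree T ⊎ (Empty X × Empty (VS T))) × X ⊆ VS T

Independent : (G : Graph) → VertexSet G → VertexSet G → Set₁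
Independent G X₁ X₂ =
  Σ[ T₁ ∈ Subgraph G ] Σ[ T₂ ∈ Subgraph G ]
    TreeCovering G X₁ T₁ × TreeCovering G X₂ T₂ × VS T₁ ⊥ VS T₂

Agile : (G : Graph) → VertexSet G → Set₁
Agile G X =
  ∀ (X₁ X₂ : VertexSet G) → X ≐ X₁ ∪ X₂ → X₁ ⊥ X₂ → Independent G X₁ X₂

-- X = {f 0, …, f (n − 1)} for distinct f i.  (A bijection of Fin n with ∃ X
-- would count membership proofs rather than elements.)
HasSize : {A : Set} → Pred A 0ℓ → ℕ → Set
HasSize {A} X n =
  Σ[ f ∈ (Fin n → A) ] Injective _≡_ _≡_ f × X ≐ (λ v → ∃[ i ] f i ≡ v)

-- H is a minor of G: G has disjoint connected branch sets indexed by the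
-- vertices of H, with an edge of G between any two that belong to adjacent
-- vertices of H.
record IsMinor (H G : Graph) : Set₁ where
  open Graph using (Adj)
  field
    branch    : V H → VertexSet G
    connected : ∀ x → Connected (induced G (branch x))
    disjoint  : ∀ {x y} → x ≢ y → branch x ⊥ branch y
    edge      : ∀ {x y} → Adj H x y →
                ∃[ u ] ∃[ v ] u ∈ branch x × v ∈ branch y × Adj G u v

CompleteBipartite : ℕ → ℕ → Graph
CompleteBipartite m n = record
  { V         = Fin m ⊎ Fin n
  ; Adj       = adj
  ; symmetric = λ {x} {y} → sym-adj x y
  ; loopless  = λ { (inj₁ _) () ; (inj₂ _) () }
  }
  where
  adj : Rel (Fin m ⊎ Fin n) 0ℓ
  adj (inj₁ _) (inj₂ _) = ⊤
  adj (inj₂ _) (inj₁ _) = ⊤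
  adj _        _        = False

  sym-adj : ∀ x y → adj x y → adj y x
  sym-adj (inj₁ _) (inj₂ _) e = e
  sym-adj (inj₂ _) (inj₁ _) e = e

{-# OPTIONS --safe #-}

-- Let a, b, c, d, e be the elements of an agile set.  The linkages ab|cd and
-- ad|bc give a 4-cycle of disjoint connected bags rooted at a, b, c, d.  Push
-- the bags of a and c (and those of b and d) towards each other along the two
-- paths of a linkage ac|bd; where this is blocked, there is a K₂,₃ minor, so
-- one arrives at a rooted K₄.  The vertex e may be assumed to lie in one of its
-- four bags, say that of a, and a linkage ab|ec cuts this bag in two, which
-- again yields a K₂,₃ minor.
--
-- Bags are lists of vertices and all case distinctions are made under a double
-- negation, since neither equality nor adjacency of vertices need be decidable.

module Submission where

open import Defs
open import Data.Product using (_×_; ∃-syntax)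
open import Relation.Nullary using (¬_)

open import Data.Fin using (Fin; zero; suc; inject₁; fromℕ; join; splitAt; punchIn)
open import Data.Fin.Patterns using (0F; 1F; 2F; 3F)
open import Data.Fin.Properties
  using (splitAt-join; punchIn-injective; punchInᵢ≢i; inject₁-injective; fromℕ≢inject₁)
  renaming (_≟_ to _≟ᶠ_)
open import Data.List using (List; []; _∷_; _++_; [_])
import Data.List as List
open import Data.List.Membership.Propositional using (_∈_; _∉_)
open import Data.List.Membership.Propositional.Properties
  using (∈-++⁺ˡ; ∈-++⁺ʳ; ∈-++⁻; ∈-lookup)
open import Data.List.Relation.Binary.Disjoint.Propositional using (Disjoint)
open import Data.List.Relation.Binary.Subset.Propositional using (_⊆_)
open import Data.List.Relation.Unary.All using (All; []; _∷_)
import Data.List.Relation.Unary.All as All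
open import Data.List.Relation.Unary.AllPairs using (AllPairs; []; _∷_)
open import Data.List.Relation.Unary.Any using (here; there)
open import Data.Nat using (ℕ; suc; _+_; _<_)
open import Data.Nat.Induction using (<-wellFounded)
open import Data.Nat.Properties using (≤-refl; +-comm; +-monoˡ-<)
open import Data.Product using (_,_; proj₁; proj₂; Σ-syntax; swap)
open import Data.Sum using (_⊎_; inj₁; inj₂; [_,_]′)
import Data.Sum as Sum
open import Function using (_∘_; id)
open import Induction.WellFounded using (Acc; acc)
open import Level using (Level; 0ℓ)
open import Relation.Binary using (Rel; Symmetric)
open import Relation.Binary.Construct.Closure.ReflexiveTransitive
  using (Star; ε; _◅_; _◅◅_)
import Relation.Binary.Construct.Closure.ReflexiveTransitive as Star
open import Relation.Binary.PropositionalEquality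
  using (_≡_; _≢_; refl; sym; trans; cong; subst; subst₂; ≢-sym)
open import Relation.Nullary using (Dec; yes; no; contradiction)
open import Relation.Nullary.Decidable using (¬¬-excluded-middle)
open import Relation.Nullary.Negation using (DoubleNegation; ¬¬-map)
open import Relation.Unary using (Pred; _⊥_)

-- Tools: double negation, disjoint lists, distributing three indices over two sides.

private
  variable
    ℓ ℓ′ : Level
    A B : Set ℓ

-- The monad of double negation, for do-notation. The statements finally refuted have conclusion
-- `False`, so a computation in it is run by applying it to `id`.
return : A → DoubleNegation A
return a k = k a

_>>=_ : DoubleNegation A → (A → DoubleNegation B) → DoubleNegation B
(m >>= f) k = m (λ a → f a k)

decide : (A : Set ℓ) → DoubleNegation (Dec A)
decide A = ¬¬-excluded-middle

-- The loop by which trails are extended: a step finishes or yields a state of smaller `size`. In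
-- every use `size` counts the steps still ahead of the trails.
descend : {A : Set ℓ} {B : Set ℓ′} (size : A → ℕ) →
  (∀ x → DoubleNegation ((Σ[ y ∈ A ] size y < size x) ⊎ B)) →
  A → DoubleNegation B
descend {A = A} {B = B} size step x = go x (<-wellFounded (size x))
  where
  go : ∀ x → Acc _<_ (size x) → DoubleNegation B
  go x (acc rec) = do
    inj₁ (y , y<x) ← step x
      where inj₂ b → return b
    go y (rec y<x)

AllPairs-lookup : {R : Rel A ℓ} {xs : List A} → Symmetric R → AllPairs R xs →
  ∀ i j → i ≢ j → R (List.lookup xs i) (List.lookup xs j)
AllPairs-lookup R-sym (r ∷ rs) zero    zero    0≢0 = contradiction refl 0≢0
AllPairs-lookup R-sym (r ∷ rs) zero    (suc j) _   = All.lookup r (∈-lookup j)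
AllPairs-lookup R-sym (r ∷ rs) (suc i) zero    _   =
  R-sym (All.lookup r (∈-lookup i))
AllPairs-lookup R-sym (r ∷ rs) (suc i) (suc j) i≢j =
  AllPairs-lookup R-sym rs i j (i≢j ∘ cong suc)

Disjoint-sym : {A : Set ℓ} → Symmetric (Disjoint {A = A})
Disjoint-sym d (x , y) = d (y , x)

Disjoint-⊆ : {A : Set ℓ} {xs xs′ ys ys′ : List A} →
  xs′ ⊆ xs → ys′ ⊆ ys → Disjoint xs ys → Disjoint xs′ ys′
Disjoint-⊆ f g d (x , y) = d (f x , g y)

Disjoint-++ˡ : {A : Set ℓ} (xs : List A) {ys zs : List A} →
  Disjoint xs zs → Disjoint ys zs → Disjoint (xs ++ ys) zs
Disjoint-++ˡ xs d d′ (x , z) =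
  [ (λ x∈xs → d (x∈xs , z)) , (λ x∈ys → d′ (x∈ys , z)) ]′ (∈-++⁻ xs x)

Disjoint-++ʳ : {A : Set ℓ} {xs : List A} (ys : List A) {zs : List A} →
  Disjoint xs ys → Disjoint xs zs → Disjoint xs (ys ++ zs)
Disjoint-++ʳ ys d d′ = Disjoint-sym (Disjoint-++ˡ ys (Disjoint-sym d) (Disjoint-sym d′))

Disjoint-[_] : {A : Set ℓ} {x : A} {ys : List A} → x ∉ ys → Disjoint [ x ] ys
Disjoint-[ x∉ys ] (here refl , x∈ys) = x∉ys x∈ys

[_]-⊆ : {A : Set ℓ} {x : A} {ys : List A} → x ∈ ys → [ x ] ⊆ ys
[ x∈ys ]-⊆ (here refl) = x∈ys

++-⊆ : {A : Set ℓ} (xs : List A) {ys zs : List A} → xs ⊆ zs → ys ⊆ zs → xs ++ ys ⊆ zs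
++-⊆ xs f g = [ f , g ]′ ∘ ∈-++⁻ xs

record TwoOne (T T′ : Pred (Fin 3) 0ℓ) : Set where
  constructor two-one
  field
    {j k l} : Fin 3
    j≢k : j ≢ k
    j≢l : j ≢ l
    k≢l : k ≢ l
    Tj  : T j
    Tk  : T k
    T′l : T′ l

all-but-one : {T T′ : Pred (Fin 3) 0ℓ} → (∀ j → T j) → ∃[ j ] T′ j → TwoOne T T′
all-but-one t (0F , t₀) = two-one {j = 1F} {2F} {0F} (λ ()) (λ ()) (λ ()) (t 1F) (t 2F) t₀
all-but-one t (1F , t₁) = two-one {j = 0F} {2F} {1F} (λ ()) (λ ()) (λ ()) (t 0F) (t 2F) t₁
all-but-one t (2F , t₂) = two-one {j = 0F} {1F} {2F} (λ ()) (λ ()) (λ ()) (t 0F) (t 1F) t₂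

-- By pigeonhole two of the three indices share a side. If the third shares it too, the assumed
-- witness of the other side takes the single place and the remaining two indices the double one.
two-versus-one : {T T′ : Pred (Fin 3) 0ℓ} → (∀ j → T j ⊎ T′ j) → ∃[ j ] T j → ∃[ j ] T′ j →
  TwoOne T T′ ⊎ TwoOne T′ T
two-versus-one cover ∃T ∃T′ with cover 0F | cover 1F | cover 2F
... | inj₁ t₀ | inj₁ t₁ | inj₁ t₂ = inj₁ (all-but-one (λ { 0F → t₀ ; 1F → t₁ ; 2F → t₂ }) ∃T′)
... | inj₂ t₀ | inj₂ t₁ | inj₂ t₂ = inj₂ (all-but-one (λ { 0F → t₀ ; 1F → t₁ ; 2F → t₂ }) ∃T)
... | inj₁ t₀ | inj₁ t₁ | inj₂ t₂ = inj₁ (two-one {j = 0F} {1F} {2F} (λ ()) (λ ()) (λ ()) t₀ t₁ t₂)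
... | inj₁ t₀ | inj₂ t₁ | inj₁ t₂ = inj₁ (two-one {j = 0F} {2F} {1F} (λ ()) (λ ()) (λ ()) t₀ t₂ t₁)
... | inj₁ t₀ | inj₂ t₁ | inj₂ t₂ = inj₂ (two-one {j = 1F} {2F} {0F} (λ ()) (λ ()) (λ ()) t₁ t₂ t₀)
... | inj₂ t₀ | inj₁ t₁ | inj₁ t₂ = inj₁ (two-one {j = 1F} {2F} {0F} (λ ()) (λ ()) (λ ()) t₁ t₂ t₀)
... | inj₂ t₀ | inj₁ t₁ | inj₂ t₂ = inj₂ (two-one {j = 0F} {2F} {1F} (λ ()) (λ ()) (λ ()) t₀ t₂ t₁)
... | inj₂ t₀ | inj₂ t₁ | inj₁ t₂ = inj₂ (two-one {j = 0F} {1F} {2F} (λ ()) (λ ()) (λ ()) t₀ t₁ t₂)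

-- Connected bags and `K₂,₃` minors.

module Bags (G : Graph) where

  open Graph G using (Adj) renaming (symmetric to Adj-sym)

  Bag : Set
  Bag = List (V G)

  private
    variable
      S T P Q : VertexSet G
      x y z : V G
      U U′ W W′ : Bag

  Walk : VertexSet G → Rel (V G) 0ℓ
  Walk S = Star (ES (induced G S))

  Walk-sym : Symmetric (Walk S)
  Walk-sym = Star.reverse (λ (u∈S , v∈S , uv) → v∈S , u∈S , Adj-sym uv)

  Walk-⊆ : (∀ {v} → S v → T v) → Walk S x y → Walk T x y
  Walk-⊆ f = Star.map (λ (u∈S , v∈S , uv) → f u∈S , f v∈S , uv)

  Conn : Bag → Set
  Conn U = Connected (induced G (_∈ U))

  Touch : Rel Bag 0ℓ
  Touch U W = ∃[ u ] ∃[ w ] u ∈ U × w ∈ W × Adj u w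

  Touch-sym : Symmetric Touch
  Touch-sym (u , w , u∈U , w∈W , uw) = w , u , w∈W , u∈U , Adj-sym uw

  Touch-⊆ : U ⊆ U′ → W ⊆ W′ → Touch U W → Touch U′ W′
  Touch-⊆ f g (u , w , u∈U , w∈W , uw) = u , w , f u∈U , g w∈W , uw

  Touch-++ˡ : ∀ U′ → Touch U W → Touch (U ++ U′) W
  Touch-++ˡ U′ = Touch-⊆ ∈-++⁺ˡ id

  Conn-[_] : ∀ v → Conn [ v ]
  Conn-[ v ] = (v , here refl) , λ { (here refl) (here refl) → ε }

  -- Gluing along an edge and gluing at a shared vertex are both instances. Every vertex is led to
  -- `x`, by way of `y` if it lies in `W`.
  Conn-linked : Conn U → Conn W → x ∈ U → y ∈ W → Walk (_∈ U ++ W) x y → Conn (U ++ W)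
  Conn-linked {U} {W} {x} {y} (_ , walkU) (_ , walkW) x∈U y∈W xy =
    (x , ∈-++⁺ˡ x∈U) , λ u v → toX u ◅◅ Walk-sym (toX v)
    where
    toX : ∀ {v} → v ∈ U ++ W → Walk (_∈ U ++ W) v x
    toX v∈ with ∈-++⁻ U v∈
    ... | inj₁ v∈U = Walk-⊆ ∈-++⁺ˡ (walkU v∈U x∈U)
    ... | inj₂ v∈W = Walk-⊆ (∈-++⁺ʳ U) (walkW v∈W y∈W) ◅◅ Walk-sym xy

  Conn-++ : Conn U → Conn W → Touch U W → Conn (U ++ W)
  Conn-++ {U} cU cW (u , w , u∈U , w∈W , uw) =
    Conn-linked cU cW u∈U w∈W ((∈-++⁺ˡ u∈U , ∈-++⁺ʳ U w∈W , uw) ◅ ε)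

  Conn-overlap : Conn U → Conn W → x ∈ U → x ∈ W → Conn (U ++ W)
  Conn-overlap cU cW x∈U x∈W = Conn-linked cU cW x∈U x∈W ε

  Conn-snoc : Conn U → x ∈ U → Adj x y → Conn (U ++ [ y ])
  Conn-snoc cU x∈U xy = Conn-++ cU Conn-[ _ ] (_ , _ , x∈U , here refl , xy)

  K₂,₃-minor : ∀ {U₁ U₂ W₁ W₂ W₃} → All Conn (U₁ ∷ U₂ ∷ W₁ ∷ W₂ ∷ W₃ ∷ []) →
    AllPairs Disjoint (U₁ ∷ U₂ ∷ W₁ ∷ W₂ ∷ W₃ ∷ []) →
    All (Touch U₁) (W₁ ∷ W₂ ∷ W₃ ∷ []) → All (Touch U₂) (W₁ ∷ W₂ ∷ W₃ ∷ []) →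
    IsMinor (CompleteBipartite 2 3) G
  K₂,₃-minor {U₁} {U₂} {W₁} {W₂} {W₃} conn disj touch₁ touch₂ = record
    { branch    = λ i → _∈ branch i
    ; connected = λ i → All.lookup conn (∈-lookup (join 2 3 i))
    ; disjoint  = λ {i} {j} i≢j →
        AllPairs-lookup Disjoint-sym disj (join 2 3 i) (join 2 3 j) (i≢j ∘ join-injective i j)
    ; edge      = λ {i} {j} → edge i j
    }
    where
    bags spokes : List Bag
    spokes = W₁ ∷ W₂ ∷ W₃ ∷ []
    bags   = U₁ ∷ U₂ ∷ spokes

    -- `join 2 3` numbers the hubs 0, 1 and the spokes 2, 3, 4, which are their positions in `bags`.
    branch : Fin 2 ⊎ Fin 3 → Bag
    branch i = List.lookup bags (join 2 3 i)

    join-injective : ∀ i j → join 2 3 i ≡ join 2 3 j → i ≡ j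
    join-injective i j eq =
      trans (sym (splitAt-join 2 3 i)) (trans (cong (splitAt 2) eq) (splitAt-join 2 3 j))

    hub-spoke : ∀ i j → Touch (branch (inj₁ i)) (branch (inj₂ j))
    hub-spoke 0F j = All.lookup touch₁ (∈-lookup {xs = spokes} j)
    hub-spoke 1F j = All.lookup touch₂ (∈-lookup {xs = spokes} j)

    edge : ∀ i j → Graph.Adj (CompleteBipartite 2 3) i j → Touch (branch i) (branch j)
    edge (inj₁ i) (inj₂ j) _ = hub-spoke i j
    edge (inj₂ j) (inj₁ i) _ = Touch-sym {branch (inj₁ i)} (hub-spoke i j)

  -- Cutting a connected bag in two.

  -- A stage in the growth of the seeds `U` and `W` inside `B`. A later stage is typed as an
  -- extension of the parts of the earlier one, so what was covered stays covered.
  record Extension (B U W : Bag) : Set where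
    field
      left right : Bag
      left-conn  : Conn left
      right-conn : Conn right
      ⊆left      : U ⊆ left
      ⊆right     : W ⊆ right
      left⊆      : left ⊆ B
      right⊆     : right ⊆ B
      disjoint   : Disjoint left right

  record Split (B U W : Bag) : Set where
    field
      extension : Extension B U W
    open Extension extension public
    field
      cover : ∀ {v} → v ∈ B → v ∈ left ⊎ v ∈ right
      touch : Touch left right

    touch-side : Touch B U′ → Touch left U′ ⊎ Touch right U′
    touch-side (u , w , u∈B , w∈W , uw) =
      Sum.map (λ u∈l → u , w , u∈l , w∈W , uw) (λ u∈r → u , w , u∈r , w∈W , uw) (cover u∈B)

  open Extension using (left; right; left-conn; right-conn; ⊆left; ⊆right)

  Extension-trans : ∀ {B} (E : Extension B U W) → Extension B (left E) (right E) →
    Extension B U W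
  Extension-trans E F = record
    { Extension F
    ; ⊆left = ⊆left F ∘ ⊆left E
    ; ⊆right = ⊆right F ∘ ⊆right E
    }

  module _ {B : Bag} where

    Covers : Extension B U W → V G → Set
    Covers E v = v ∈ left E ⊎ v ∈ right E

    Covers-trans : (E : Extension B U W) (F : Extension B (left E) (right E)) →
      ∀ {v} → Covers E v → Covers F v
    Covers-trans E F = Sum.map (⊆left F) (⊆right F)

    -- A vertex of the walk that is not yet covered joins the side of its predecessor, which keeps
    -- that side connected.
    cover-walk : (E : Extension B U W) → Covers E x → Walk (_∈ B) x y →
      DoubleNegation (Σ[ F ∈ Extension B (left E) (right E) ] Covers F y)
    cover-walk E x∈ ε = return (record { Extension E ; ⊆left = id ; ⊆right = id } , x∈)
    cover-walk {y = y} E x∈ (_◅_ {j = z} (_ , z∈B , xz) w) = do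
      no z∉left ← decide (z ∈ left E)
        where yes z∈ → cover-walk E (inj₁ z∈) w
      no z∉right ← decide (z ∈ right E)
        where yes z∈ → cover-walk E (inj₂ z∈) w
      let E′ = enlarge z∉left z∉right x∈
      (F , y∈) ← cover-walk (Extension-trans E (proj₁ E′)) (proj₂ E′) w
      return (Extension-trans (proj₁ E′) F , y∈)
      where
      enlarge : z ∉ left E → z ∉ right E → Covers E _ →
        Σ[ F ∈ Extension B (left E) (right E) ] Covers F z
      enlarge _ z∉right (inj₁ x∈l) = record
        { left = left E ++ [ z ]
        ; right = right E
        ; left-conn = Conn-snoc (left-conn E) x∈l xz
        ; right-conn = right-conn E
        ; ⊆left = ∈-++⁺ˡ
        ; ⊆right = id
        ; left⊆ = ++-⊆ (left E) (Extension.left⊆ E) [ z∈B ]-⊆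
        ; right⊆ = Extension.right⊆ E
        ; disjoint = Disjoint-++ˡ (left E) (Extension.disjoint E) Disjoint-[ z∉right ]
        } , inj₁ (∈-++⁺ʳ (left E) (here refl))
      enlarge z∉left _ (inj₂ x∈r) = record
        { left = left E
        ; right = right E ++ [ z ]
        ; left-conn = left-conn E
        ; right-conn = Conn-snoc (right-conn E) x∈r xz
        ; ⊆left = id
        ; ⊆right = ∈-++⁺ˡ
        ; left⊆ = Extension.left⊆ E
        ; right⊆ = ++-⊆ (right E) (Extension.right⊆ E) [ z∈B ]-⊆
        ; disjoint = Disjoint-++ʳ (right E) (Extension.disjoint E)
            (Disjoint-sym Disjoint-[ z∉left ])
        } , inj₂ (∈-++⁺ʳ (right E) (here refl))

    -- The recursion runs over the list `vs` of targets, while the walks to them may use all of `B`.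
    cover-all : Conn B → (E : Extension B U W) → ∀ {vs} → vs ⊆ B → DoubleNegation
      (Σ[ F ∈ Extension B (left E) (right E) ] (∀ {v} → v ∈ vs → Covers F v))
    cover-all conn E {[]} _ = return (record { Extension E ; ⊆left = id ; ⊆right = id } , λ ())
    cover-all conn E {v ∷ vs} vs⊆B = do
      let (p , p∈left) = proj₁ (left-conn E)
      (F , v∈F) ← cover-walk E (inj₁ p∈left)
        (proj₂ conn (Extension.left⊆ E p∈left) (vs⊆B (here refl)))
      (F′ , covers) ← cover-all conn (Extension-trans E F) (vs⊆B ∘ there)
      return (Extension-trans F F′ , λ
        { (here refl) → Covers-trans F F′ v∈F
        ; (there u∈)  → covers u∈ })

    -- The first step of the walk that lands in `W` is the edge sought.
    crossing : Disjoint U W → (∀ {v} → v ∈ B → v ∈ U ⊎ v ∈ W) →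
      x ∈ U → y ∈ W → Walk (_∈ B) x y → Touch U W
    crossing disj cov x∈U x∈W ε = contradiction (x∈U , x∈W) disj
    crossing disj cov x∈U y∈W ((_ , z∈B , xz) ◅ w) with cov z∈B
    ... | inj₁ z∈U = crossing disj cov z∈U y∈W w
    ... | inj₂ z∈W = _ , _ , x∈U , z∈W , xz

    -- The seeds grow along walks of `B` until they exhaust it. A walk of `B` from one part to the
    -- other must then cross directly between them.
    split : Conn B → Conn U → Conn W → U ⊆ B → W ⊆ B → Disjoint U W →
      DoubleNegation (Split B U W)
    split conn connU connW U⊆B W⊆B disj = do
      (E , covers) ← cover-all conn record
        { left-conn = connU ; right-conn = connW ; ⊆left = id ; ⊆right = id
        ; left⊆ = U⊆B ; right⊆ = W⊆B ; disjoint = disj } id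
      let (p , p∈left)  = proj₁ (left-conn E)
          (q , q∈right) = proj₁ (right-conn E)
      return record
        { extension = E
        ; cover = covers
        ; touch = crossing (Extension.disjoint E) covers p∈left q∈right
            (proj₂ conn (Extension.left⊆ E p∈left) (Extension.right⊆ E q∈right))
        }

  -- Walks, and trails that follow them step by step.

  steps : Walk S x y → ℕ
  steps ε       = 0
  steps (_ ◅ w) = suc (steps w)

  vertices : Walk S x y → Bag
  vertices {x = x} ε       = [ x ]
  vertices {x = x} (_ ◅ w) = x ∷ vertices w

  start∈vertices : (w : Walk S x y) → x ∈ vertices w
  start∈vertices ε       = here refl
  start∈vertices (_ ◅ w) = here refl

  end∈vertices : (w : Walk S x y) → y ∈ vertices w
  end∈vertices ε       = here refl
  end∈vertices (_ ◅ w) = there (end∈vertices w)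

  vertices⊆ : S x → (w : Walk S x y) → ∀ {v} → v ∈ vertices w → S v
  vertices⊆ x∈S ε                   (here refl) = x∈S
  vertices⊆ x∈S (_ ◅ w)             (here refl) = x∈S
  vertices⊆ x∈S ((_ , z∈S , _) ◅ w) (there v∈w) = vertices⊆ z∈S w v∈w

  vertices-conn : (w : Walk S x y) → Conn (vertices w)
  vertices-conn ε                  = Conn-[ _ ]
  vertices-conn ((_ , _ , xz) ◅ w) =
    Conn-++ Conn-[ _ ] (vertices-conn w) (_ , _ , here refl , start∈vertices w , xz)

  record Detached (w : Walk S x y) (v : V G) : Set where
    constructor detached
    field
      {first} : V G
      first∈S : S first
      suffix  : Walk S first y
      suffix⊆ : vertices suffix ⊆ vertices w
      fresh   : v ∉ vertices suffix
      joined  : Adj v first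

  -- Walks may repeat vertices, so the suffix is taken behind the last visit to `z`. Since `z ≢ y`,
  -- a step follows that visit.
  detach : (w : Walk S x y) → z ∈ vertices w → z ≢ y → DoubleNegation (Detached w z)
  detach ε (here refl) z≢y = contradiction refl z≢y
  detach {z = z} (_◅_ {i = x} (_ , u∈S , xu) w) z∈ z≢y = do
    yes z∈w ← decide (z ∈ vertices w)
      where no z∉w → return (last z∉w z∈)
    detached f s s⊆ fr j ← detach w z∈w z≢y
    return (detached f s (there ∘ s⊆) fr j)
    where
    last : z ∉ vertices w → z ∈ x ∷ vertices w → Detached _ z
    last z∉w (here refl) = detached u∈S w there z∉w xu
    last z∉w (there z∈w) = contradiction z∈w z∉w

  -- A walk from x to y inside S, of which the part up to tip has already been
  -- walked along; that part is only remembered as a connected bag.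
  record Trail (S : VertexSet G) (x y : V G) : Set where
    field
      trace      : Bag
      trace-conn : Conn trace
      trace⊆S    : ∀ {v} → v ∈ trace → S v
      root∈      : x ∈ trace
      tip        : V G
      tip∈       : tip ∈ trace
      rest       : Walk S tip y

  open Trail

  Disjoint-traces : S ⊥ T → ∀ {u v} (t : Trail S x y) (t′ : Trail T u v) →
    Disjoint (trace t) (trace t′)
  Disjoint-traces S⊥T t t′ (v∈t , v∈t′) = S⊥T (trace⊆S t v∈t , trace⊆S t′ v∈t′)

  begin-trail : S x → Walk S x y → Trail S x y
  begin-trail x∈S w = record
    { trace = [ _ ] ; trace-conn = Conn-[ _ ] ; trace⊆S = λ { (here refl) → x∈S }
    ; root∈ = here refl ; tip = _ ; tip∈ = here refl ; rest = w }

  record Exit (t : Trail S x y) : Set where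
    field
      next    : V G
      next∈S  : S next
      tip-adj : Adj (tip t) next
      onward  : Walk S next y
      shorter : steps onward < steps (rest t)

    tip-touch : ∀ {U W} → tip t ∈ U → next ∈ W → Touch U W
    tip-touch tip∈U next∈W = _ , _ , tip∈U , next∈W , tip-adj

  open Exit

  exit : (t : Trail S x y) → y ∉ trace t → Exit t
  exit record { rest = ε ; tip∈ = tip∈ } y∉ = contradiction tip∈ y∉
  exit record { rest = (_ , z∈S , e) ◅ w } _ = record
    { next∈S = z∈S ; tip-adj = e ; onward = w ; shorter = ≤-refl }

  advance : (t : Trail S x y) → Exit t → Trail S x y
  advance t e = record
    { trace = trace t ++ [ next e ]
    ; trace-conn = Conn-snoc (trace-conn t) (tip∈ t) (tip-adj e)
    ; trace⊆S = λ v∈ → [ trace⊆S t , (λ { (here refl) → next∈S e }) ]′ (∈-++⁻ (trace t) v∈)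
    ; root∈ = ∈-++⁺ˡ (root∈ t)
    ; tip = next e
    ; tip∈ = ∈-++⁺ʳ (trace t) (here refl)
    ; rest = onward e
    }

  record Reaching (O : VertexSet G) (S : VertexSet G) (x y : V G) : Set where
    field
      trail  : Trail S x y
      avoids : (_∈ trace trail) ⊥ O

  Reaches : ∀ {O} → Reaching O S x y → Set
  Reaches {O = O} r = ∃[ u ] ∃[ v ] u ∈ trace (Reaching.trail r) × O v × Adj u v

  -- The trail halts one step before it would first enter `O`. It cannot run on forever without
  -- doing so, because its target `y` lies in `O`.
  reach : ∀ {O} → O y → Reaching O S x y →
    DoubleNegation (Σ[ r ∈ Reaching O S x y ] Reaches r)
  reach {O = O} y∈O = descend (λ r → steps (rest (Reaching.trail r))) λ r → do
    let open Reaching r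
        e = exit trail (λ y∈ → avoids (y∈ , y∈O))
    no next∉O ← decide (O (next e))
      where yes next∈O → return (inj₂ (r , _ , _ , tip∈ trail , next∈O , tip-adj e))
    return (inj₁ (record
      { trail = advance trail e
      ; avoids = λ { (v∈ , v∈O) → [ (λ v∈t → avoids (v∈t , v∈O))
                                  , (λ { (here refl) → next∉O v∈O }) ]′
                                  (∈-++⁻ (trace trail) v∈) }
      } , shorter e))

  -- A rooted four-cycle from two linkages.

  -- The linkage ab|cd. Of the two disjoint trees only the vertex sets and one walk in each are
  -- kept.
  record Linkage (a b c d : V G) : Set₁ where
    field
      left right : VertexSet G
      left⊥right : left ⊥ right
      a∈ : left a
      b∈ : left b
      c∈ : right c
      d∈ : right d
      ab : Walk left a b
      cd : Walk right c d

  -- Two neighbouring bags of the future cycle. The bag of `x` is a trail towards `z` along one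
  -- linkage; the bag of `y` is what is left of the path from `x` to `y` of the other linkage.
  record Arm (P S : VertexSet G) (x y z : V G) : Set where
    field
      trail : Trail S x z
      {start} : V G
      start∈P : P start
      path  : Walk P start y
      touch : Touch (trace trail) (vertices path)
      apart : Disjoint (trace trail) (vertices path)

    path-vertices : Bag
    path-vertices = vertices path

  -- Once each trail is adjacent to the path of the other arm, the two traces and
  -- the two paths form a 4-cycle.
  record Rails (P Q S T : VertexSet G) (a b c d : V G) : Set where
    field
      arm₁ : Arm P S a b d
      arm₂ : Arm Q T c d b
    module A₁ = Arm arm₁
    module A₂ = Arm arm₂
    field
      apart₁₂ : Disjoint (trace A₁.trail) A₂.path-vertices
      apart₂₁ : Disjoint (trace A₂.trail) A₁.path-vertices

    size : ℕ
    size = steps (rest A₁.trail) + steps (rest A₂.trail)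

  turn : ∀ {a b c d} → Rails P Q S T a b c d → Rails Q P T S c d a b
  turn R = record { arm₁ = arm₂ ; arm₂ = arm₁ ; apart₁₂ = apart₂₁ ; apart₂₁ = apart₁₂ }
    where open Rails R

  Meets : ∀ {a b c d} → Rails P Q S T a b c d → Set
  Meets R = Touch (trace A₁.trail) A₂.path-vertices
    where open Rails R

  -- If the trail of arm₁ runs into the path of arm₁, the path is cut off
  -- behind the last such vertex.
  push : ∀ {a b c d} → S ⊥ T → T b → (R : Rails P Q S T a b c d) →
    DoubleNegation ((Σ[ R′ ∈ Rails P Q S T a b c d ] Rails.size R′ < Rails.size R) ⊎ Meets R)
  push {S = S} {T = T} {P = P} {b = b} {d = d} S⊥T b∈T R = do
    no r∉path₂ ← decide (r ∈ A₂.path-vertices)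
      where yes r∈ → return (inj₂ (_ , _ , tip∈ A₁.trail , r∈ , tip-adj e))
    no r∉path₁ ← decide (r ∈ A₁.path-vertices)
      where
      yes r∈ → do
        D ← detach A₁.path r∈ (λ r≡b → S⊥T (next∈S e , subst T (sym r≡b) b∈T))
        let open Detached D
        return (inj₁ (advanced r∉path₂ first∈S suffix suffix⊆ fresh
          (_ , _ , ∈-++⁺ʳ (trace A₁.trail) (here refl) , start∈vertices suffix , joined)))
    return (inj₁ (advanced r∉path₂ A₁.start∈P A₁.path id r∉path₁ (Touch-++ˡ _ A₁.touch)))
    where
    open Rails R
    e = exit A₁.trail (λ d∈ → apart₁₂ (d∈ , end∈vertices A₂.path))
    r = next e

    advanced : r ∉ A₂.path-vertices → ∀ {s} → P s → (w : Walk P s b) →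
      vertices w ⊆ A₁.path-vertices → r ∉ vertices w →
      Touch (trace A₁.trail ++ [ r ]) (vertices w) →
      Σ[ R′ ∈ _ ] Rails.size R′ < size
    advanced r∉path₂ s∈P w w⊆ r∉w touch = record
      { arm₁ = record
        { trail = advance A₁.trail e
        ; start∈P = s∈P
        ; path = w
        ; touch = touch
        ; apart = Disjoint-++ˡ (trace A₁.trail) (Disjoint-⊆ id w⊆ A₁.apart) Disjoint-[ r∉w ]
        }
      ; arm₂ = arm₂
      ; apart₁₂ = Disjoint-++ˡ (trace A₁.trail) apart₁₂ Disjoint-[ r∉path₂ ]
      ; apart₂₁ = Disjoint-⊆ id w⊆ apart₂₁
      } , +-monoˡ-< _ (shorter e)

  record FourCycle (a b c d : V G) : Set where
    field
      {bagA bagB bagC bagD} : Bag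
      connA : Conn bagA
      connB : Conn bagB
      connC : Conn bagC
      connD : Conn bagD
      a∈ : a ∈ bagA
      b∈ : b ∈ bagB
      c∈ : c ∈ bagC
      d∈ : d ∈ bagD
      A~B : Touch bagA bagB
      B~C : Touch bagB bagC
      C~D : Touch bagC bagD
      D~A : Touch bagD bagA
      AB : Disjoint bagA bagB
      BC : Disjoint bagB bagC
      CD : Disjoint bagC bagD
      DA : Disjoint bagD bagA
      AC : Disjoint bagA bagC
      BD : Disjoint bagB bagD

  -- The trails of `a` and `c` follow `L′` towards `d` and `b`, each until it is adjacent to the
  -- `L`-path ending there. The two traces lie on different sides of `L′` and the two remaining
  -- paths on different sides of `L`, so opposite bags are disjoint.
  four-cycle : ∀ {a b c d} → Linkage a b c d → Linkage a d c b →
    DoubleNegation (FourCycle a b c d)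
  four-cycle {a} {b} {c} {d} L L′ = do
    -- Each path is cut behind the last visit to its own start, so that the initial one-vertex trace
    -- is adjacent to the path but not on it.
    path₁ ← detach L.ab (start∈vertices L.ab) (λ { refl → M.left⊥right (M.a∈ , M.d∈) })
    path₂ ← detach L.cd (start∈vertices L.cd) (λ { refl → M.left⊥right (M.b∈ , M.c∈) })
    (R , D~A , B~C) ← descend Rails.size step (initial path₁ path₂)
    let open Rails R
    return record
      { connA = trace-conn A₁.trail
      ; connB = vertices-conn A₁.path
      ; connC = trace-conn A₂.trail
      ; connD = vertices-conn A₂.path
      ; a∈ = root∈ A₁.trail
      ; b∈ = end∈vertices A₁.path
      ; c∈ = root∈ A₂.trail
      ; d∈ = end∈vertices A₂.path
      ; A~B = A₁.touch
      ; B~C = Touch-sym B~C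
      ; C~D = A₂.touch
      ; D~A = Touch-sym D~A
      ; AB = A₁.apart
      ; BC = Disjoint-sym apart₂₁
      ; CD = A₂.apart
      ; DA = Disjoint-sym apart₁₂
      ; AC = Disjoint-traces M.left⊥right A₁.trail A₂.trail
      ; BD = λ (v∈₁ , v∈₂) → L.left⊥right
          (vertices⊆ A₁.start∈P A₁.path v∈₁ , vertices⊆ A₂.start∈P A₂.path v∈₂)
      }
    where
    module L = Linkage L
    module M = Linkage L′

    initial : Detached L.ab a → Detached L.cd c → Rails L.left L.right M.left M.right a b c d
    initial D₁ D₂ = record
      { arm₁ = arm M.a∈ M.ab D₁
      ; arm₂ = arm M.c∈ M.cd D₂
      ; apart₁₂ = Disjoint-[ (λ a∈ → L.left⊥right (L.a∈ ,
          vertices⊆ L.c∈ L.cd (Detached.suffix⊆ D₂ a∈))) ]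
      ; apart₂₁ = Disjoint-[ (λ c∈ → L.left⊥right (
          vertices⊆ L.a∈ L.ab (Detached.suffix⊆ D₁ c∈) , L.c∈)) ]
      }
      where
      arm : ∀ {S P x y z} {w : Walk P x y} → S x → Walk S x z → Detached w x → Arm P S x y z
      arm x∈S w D = record
        { trail = begin-trail x∈S w
        ; start∈P = first∈S
        ; path = suffix
        ; touch = _ , _ , here refl , start∈vertices suffix , joined
        ; apart = Disjoint-[ fresh ]
        }
        where open Detached D

    step : (R : Rails L.left L.right M.left M.right a b c d) →
      DoubleNegation ((Σ[ R′ ∈ _ ] Rails.size R′ < Rails.size R) ⊎
                      (Σ[ R′ ∈ Rails L.left L.right M.left M.right a b c d ]
                        Meets R′ × Meets (turn R′)))
    step R = do
      inj₂ meets ← push M.left⊥right M.d∈ R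
        where inj₁ smaller → return (inj₁ smaller)
      inj₂ meets′ ← push (M.left⊥right ∘ swap) M.b∈ (turn R)
        where inj₁ (R′ , R′<) → return (inj₁ (turn R′ , turn-< R′ R′<))
      return (inj₂ (R , meets , meets′))
      where
      size-turn : ∀ {P Q S T a b c d} (R : Rails P Q S T a b c d) →
        Rails.size (turn R) ≡ Rails.size R
      size-turn R = +-comm (steps (rest (Arm.trail (Rails.arm₂ R)))) _

      turn-< : ∀ R′ → Rails.size R′ < Rails.size (turn R) →
        Rails.size (turn R′) < Rails.size R
      turn-< R′ = subst₂ _<_ (sym (size-turn R′)) (size-turn R)

  -- Symmetries and moves of a four-cycle equipped with trails.

  -- The reflection that fixes `a` and `c`; `flip` is the one that exchanges `a` with `b` and `c`
  -- with `d`. With both, it is enough to treat the trail of `a` and its collision with the bag of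
  -- `b`.
  mirror : ∀ {a b c d} → FourCycle a b c d → FourCycle a d c b
  mirror F = record
    { connA = connA ; connB = connD ; connC = connC ; connD = connB
    ; a∈ = a∈ ; b∈ = d∈ ; c∈ = c∈ ; d∈ = b∈
    ; A~B = Touch-sym D~A ; B~C = Touch-sym C~D ; C~D = Touch-sym B~C ; D~A = Touch-sym A~B
    ; AB = Disjoint-sym DA ; BC = Disjoint-sym CD ; CD = Disjoint-sym BC ; DA = Disjoint-sym AB
    ; AC = AC ; BD = Disjoint-sym BD
    }
    where open FourCycle F

  flip : ∀ {a b c d} → FourCycle a b c d → FourCycle b a d c
  flip F = record
    { connA = connB ; connB = connA ; connC = connD ; connD = connC
    ; a∈ = b∈ ; b∈ = a∈ ; c∈ = d∈ ; d∈ = c∈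
    ; A~B = Touch-sym A~B ; B~C = Touch-sym D~A ; C~D = Touch-sym C~D ; D~A = Touch-sym B~C
    ; AB = Disjoint-sym AB ; BC = Disjoint-sym DA ; CD = Disjoint-sym CD ; DA = Disjoint-sym BC
    ; AC = BD ; BD = AC
    }
    where open FourCycle F

  -- A four-cycle on which the linkage ac|bd is followed from all four roots. When a bag is cut, the
  -- part that keeps the root also has to keep the trace; this is what the inclusions are for.
  record Routed (S T : VertexSet G) (a b c d : V G) : Set where
    field
      cycle : FourCycle a b c d
    open FourCycle cycle public
    field
      trailA  : Trail S a c
      trailB  : Trail T b d
      trailC  : Trail S c a
      trailD  : Trail T d b
      traceA⊆ : trace trailA ⊆ bagA
      traceB⊆ : trace trailB ⊆ bagB
      traceC⊆ : trace trailC ⊆ bagC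
      traceD⊆ : trace trailD ⊆ bagD

    size : ℕ
    size = (steps (rest trailA) + steps (rest trailC)) + (steps (rest trailB) + steps (rest trailD))

    exitA : Exit trailA
    exitA = exit trailA (λ c∈A → AC (traceA⊆ c∈A , c∈))

    exitB : Exit trailB
    exitB = exit trailB (λ d∈B → BD (traceB⊆ d∈B , d∈))

  record Smaller {a b c d} (R : Routed S T a b c d) : Set where
    constructor smaller
    field
      routed : Routed S T a b c d
      size-< : Routed.size routed < Routed.size R

  mirrorR : ∀ {a b c d} → Routed S T a b c d → Routed S T a d c b
  mirrorR R = record
    { cycle = mirror cycle
    ; trailA = trailA ; trailB = trailD ; trailC = trailC ; trailD = trailB
    ; traceA⊆ = traceA⊆ ; traceB⊆ = traceD⊆ ; traceC⊆ = traceC⊆ ; traceD⊆ = traceB⊆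
    }
    where open Routed R

  flipR : ∀ {a b c d} → Routed S T a b c d → Routed T S b a d c
  flipR R = record
    { cycle = flip cycle
    ; trailA = trailB ; trailB = trailA ; trailC = trailD ; trailD = trailC
    ; traceA⊆ = traceB⊆ ; traceB⊆ = traceA⊆ ; traceC⊆ = traceD⊆ ; traceD⊆ = traceC⊆
    }
    where open Routed R

  mirror-smaller : ∀ {a b c d} {R : Routed S T a b c d} → Smaller (mirrorR R) → Smaller R
  mirror-smaller {R = R} (smaller R′ R′<) =
    smaller (mirrorR R′) (subst₂ _<_ (sym (size-mirror R′)) (size-mirror R) R′<)
    where
    size-mirror : ∀ {a b c d} (R : Routed S T a b c d) → Routed.size (mirrorR R) ≡ Routed.size R
    size-mirror R = cong (steps (rest trailA) + steps (rest trailC) +_)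
      (+-comm (steps (rest trailD)) (steps (rest trailB)))
      where open Routed R

  flip-smaller : ∀ {a b c d} {R : Routed S T a b c d} → Smaller (flipR R) → Smaller R
  flip-smaller {R = R} (smaller R′ R′<) =
    smaller (flipR R′) (subst₂ _<_ (sym (size-flip R′)) (size-flip R) R′<)
    where
    size-flip : ∀ {S T a b c d} (R : Routed S T a b c d) → Routed.size (flipR R) ≡ Routed.size R
    size-flip R = +-comm (steps (rest trailB) + steps (rest trailD)) _
      where open Routed R

  -- The common move: A takes over `X` with the next vertex of its trail, and B shrinks to `B`. It
  -- serves both for a vertex outside the other bags, with B unchanged, and for a part cut off from
  -- B. The size drops because the trail of `a` advances and the others stay.
  transfer : ∀ {a b c d} (R : Routed S T a b c d) → let open Routed R in ∀ {X B} →
    next exitA ∈ X → Conn X → Disjoint X B → Disjoint X bagC → Disjoint X bagD →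
    trace trailB ⊆ B → B ⊆ bagB → Conn B →
    Touch (bagA ++ X) B → Touch B bagC → Smaller R
  transfer R {X} {B} r∈X connX XB XC XD trace⊆B B⊆bagB connB′ A~B′ B′~C = smaller record
    { cycle = record
      { connA = Conn-++ connA connX (tip-touch exitA (traceA⊆ (tip∈ trailA)) r∈X)
      ; connB = connB′
      ; connC = connC
      ; connD = connD
      ; a∈ = ∈-++⁺ˡ a∈
      ; b∈ = trace⊆B (root∈ trailB)
      ; c∈ = c∈
      ; d∈ = d∈
      ; A~B = A~B′
      ; B~C = B′~C
      ; C~D = C~D
      ; D~A = Touch-⊆ id ∈-++⁺ˡ D~A
      ; AB = Disjoint-++ˡ bagA (Disjoint-⊆ id B⊆bagB AB) XB
      ; BC = Disjoint-⊆ B⊆bagB id BC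
      ; CD = CD
      ; DA = Disjoint-++ʳ bagA DA (Disjoint-sym XD)
      ; AC = Disjoint-++ˡ bagA AC XC
      ; BD = Disjoint-⊆ B⊆bagB id BD
      }
    ; trailA = advance trailA exitA
    ; trailB = trailB
    ; trailC = trailC
    ; trailD = trailD
    ; traceA⊆ = ++-⊆ (trace trailA) (∈-++⁺ˡ ∘ traceA⊆) (∈-++⁺ʳ bagA ∘ [ r∈X ]-⊆)
    ; traceB⊆ = trace⊆B
    ; traceC⊆ = traceC⊆
    ; traceD⊆ = traceD⊆
    } (+-monoˡ-< _ (+-monoˡ-< _ (shorter exitA)))
    where open Routed R

  -- The next vertex may lie in `bagA` already; listing it a second time is harmless.
  absorb : ∀ {a b c d} (R : Routed S T a b c d) → let open Routed R in
    next exitA ∉ bagB → next exitA ∉ bagC → next exitA ∉ bagD → Smaller R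
  absorb R r∉B r∉C r∉D = transfer R (here refl) Conn-[ _ ]
    Disjoint-[ r∉B ] Disjoint-[ r∉C ] Disjoint-[ r∉D ] traceB⊆ id connB (Touch-++ˡ _ A~B) B~C
    where open Routed R

  -- From the four-cycle to a rooted `K₄`.

  record RootedK₄ (root : Fin 4 → V G) : Set where
    field
      bag      : Fin 4 → Bag
      conn     : ∀ i → Conn (bag i)
      root∈bag : ∀ i → root i ∈ bag i
      disjoint : ∀ {i j} → i ≢ j → Disjoint (bag i) (bag j)
      touch    : ∀ {i j} → i ≢ j → Touch (bag i) (bag j)

  complete : ∀ {root} (F : FourCycle (root 0F) (root 1F) (root 2F) (root 3F)) →
    let open FourCycle F in Touch bagA bagC → Touch bagB bagD → RootedK₄ root
  complete F A~C B~D = record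
    { bag = List.lookup (bagA ∷ bagB ∷ bagC ∷ bagD ∷ [])
    ; conn = λ { 0F → connA ; 1F → connB ; 2F → connC ; 3F → connD }
    ; root∈bag = λ { 0F → a∈ ; 1F → b∈ ; 2F → c∈ ; 3F → d∈ }
    ; disjoint = AllPairs-lookup {R = Disjoint} Disjoint-sym
        ((AB ∷ AC ∷ Disjoint-sym DA ∷ []) ∷ (BC ∷ BD ∷ []) ∷ (CD ∷ []) ∷ [] ∷ []) _ _
    ; touch = AllPairs-lookup {R = Touch} Touch-sym
        ((A~B ∷ A~C ∷ Touch-sym D~A ∷ []) ∷ (B~C ∷ B~D ∷ []) ∷ (C~D ∷ []) ∷ [] ∷ []) _ _
    }
    where open FourCycle F

  module _ (K₂,₃-free : ¬ IsMinor (CompleteBipartite 2 3) G) where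

    -- The trail of A runs into B.  Cut B into left ∋ r and right ⊇ traceB, and
    -- move left to A unless this separates B from C.  In that case the trail of
    -- B has to leave right; it can only run into A, and if in the same way
    -- cutting A separates A from D, then the two cut-off parts are the hubs of
    -- a K₂,₃ with spokes (rest of A), (rest of B) and C ∪ D.
    intrusion : ∀ {a b c d} → S ⊥ T → (R : Routed S T a b c d) → let open Routed R in
      next exitA ∈ bagB → DoubleNegation (Smaller R)
    intrusion S⊥T R r∈B = do
      B ← split connB Conn-[ r ] (trace-conn trailB) [ r∈B ]-⊆ traceB⊆
        Disjoint-[ (λ r∈ → S⊥T (next∈S exitA , trace⊆S trailB r∈)) ]
      let module B = Split B
          r∈left = B.⊆left (here refl)
          tip∈right = B.⊆right (tip∈ trailB)
      no right≁C ← decide (Touch B.right bagC)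
        where yes right~C → return (transfer R r∈left B.left-conn B.disjoint
                (Disjoint-⊆ B.left⊆ id BC) (Disjoint-⊆ B.left⊆ id BD)
                B.⊆right B.right⊆ B.right-conn
                (Touch-⊆ (∈-++⁺ʳ bagA) id B.touch) right~C)
      let left~C = [ id , (λ t → contradiction t right≁C) ]′ (B.touch-side B~C)
      no s∉C ← decide (s ∈ bagC)
        where yes s∈C → contradiction (tip-touch exitB tip∈right s∈C) right≁C
      no s∉D ← decide (s ∈ bagD)
        where
        -- Now `B.right` touches D. Hence `B.left` and D are the hubs of a `K₂,₃` with spokes A, C
        -- and `B.right`.
        yes s∈D → contradiction
          (K₂,₃-minor {B.left} {bagD} {bagA} {bagC} {B.right}
            (B.left-conn ∷ connD ∷ connA ∷ connC ∷ B.right-conn ∷ [])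
            ( (Disjoint-⊆ B.left⊆ id BD ∷ Disjoint-⊆ B.left⊆ id (Disjoint-sym AB)
                ∷ Disjoint-⊆ B.left⊆ id BC ∷ B.disjoint ∷ [])
            ∷ (DA ∷ Disjoint-sym CD ∷ Disjoint-⊆ id B.right⊆ (Disjoint-sym BD) ∷ [])
            ∷ (AC ∷ Disjoint-⊆ id B.right⊆ AB ∷ [])
            ∷ (Disjoint-⊆ id B.right⊆ (Disjoint-sym BC) ∷ [])
            ∷ [] ∷ [])
            (Touch-sym (tip-touch exitA tip∈A r∈left) ∷ left~C ∷ B.touch ∷ [])
            (D~A ∷ Touch-sym C~D ∷ Touch-sym (tip-touch exitB tip∈right s∈D) ∷ []))
          K₂,₃-free
      -- If `s` lies in none of the other three bags, the cut of B is dropped and the trail of `b`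
      -- advances; this includes every `s` inside B, on either side of the cut.
      yes s∈A ← decide (s ∈ bagA)
        where no s∉A → return (flip-smaller (absorb (flipR R) s∉A s∉D s∉C))
      A ← split connA Conn-[ s ] (trace-conn trailA) [ s∈A ]-⊆ traceA⊆
        Disjoint-[ (λ s∈ → S⊥T (trace⊆S trailA s∈ , next∈S exitB)) ]
      let module A = Split A
          s∈left = A.⊆left (here refl)
          tip∈right′ = A.⊆right (tip∈ trailA)
      no right≁D ← decide (Touch A.right bagD)
        where yes right~D → return (flip-smaller (transfer (flipR R) s∈left A.left-conn A.disjoint
                (Disjoint-⊆ A.left⊆ id (Disjoint-sym DA)) (Disjoint-⊆ A.left⊆ id AC)
                A.⊆right A.right⊆ A.right-conn
                (Touch-⊆ (∈-++⁺ʳ bagB) id A.touch) right~D))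
      let left~D = [ id , (λ t → contradiction t right≁D) ]′ (A.touch-side (Touch-sym D~A))
      contradiction
        (K₂,₃-minor {B.left} {A.left} {A.right} {B.right} {bagC ++ bagD}
          (B.left-conn ∷ A.left-conn ∷ A.right-conn ∷ B.right-conn ∷ Conn-++ connC connD C~D ∷ [])
          ( (Disjoint-⊆ B.left⊆ A.left⊆ (Disjoint-sym AB)
              ∷ Disjoint-⊆ B.left⊆ A.right⊆ (Disjoint-sym AB)
              ∷ B.disjoint
              ∷ Disjoint-⊆ B.left⊆ id (Disjoint-++ʳ bagC BC BD) ∷ [])
          ∷ (A.disjoint ∷ Disjoint-⊆ A.left⊆ B.right⊆ AB
              ∷ Disjoint-⊆ A.left⊆ id (Disjoint-++ʳ bagC AC (Disjoint-sym DA)) ∷ [])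
          ∷ (Disjoint-⊆ A.right⊆ B.right⊆ AB
              ∷ Disjoint-⊆ A.right⊆ id (Disjoint-++ʳ bagC AC (Disjoint-sym DA)) ∷ [])
          ∷ (Disjoint-⊆ B.right⊆ id (Disjoint-++ʳ bagC BC BD) ∷ [])
          ∷ [] ∷ [])
          (Touch-sym (tip-touch exitA tip∈right′ r∈left) ∷ B.touch ∷ Touch-⊆ id ∈-++⁺ˡ left~C ∷ [])
          (A.touch ∷ Touch-sym (tip-touch exitB tip∈right s∈left)
            ∷ Touch-⊆ id (∈-++⁺ʳ bagC) left~D ∷ []))
        K₂,₃-free
      where
      open Routed R
      r = next exitA
      s = next exitB
      tip∈A = traceA⊆ (tip∈ trailA)

    -- The cases are sorted by the bag in which the next vertex of the trail of `a` lies. Entering C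
    -- gives the diagonal, entering B or D is an intrusion, and any other vertex is absorbed.
    chord : ∀ {a b c d} → S ⊥ T → (R : Routed S T a b c d) → let open Routed R in
      DoubleNegation (Smaller R ⊎ Touch bagA bagC)
    chord S⊥T R = do
      no r∉C ← decide (next exitA ∈ bagC)
        where yes r∈C → return (inj₂ (tip-touch exitA (traceA⊆ (tip∈ trailA)) r∈C))
      no r∉B ← decide (next exitA ∈ bagB)
        where yes r∈B → ¬¬-map inj₁ (intrusion S⊥T R r∈B)
      no r∉D ← decide (next exitA ∈ bagD)
        where yes r∈D → ¬¬-map (inj₁ ∘ mirror-smaller) (intrusion S⊥T (mirrorR R) r∈D)
      return (inj₁ (absorb R r∉B r∉C r∉D))
      where open Routed R

    -- Whenever `chord` does not deliver a diagonal it leaves a smaller routed cycle, so eventually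
    -- both diagonals are found on one and the same cycle.
    rooted-K₄ : ∀ {root} → FourCycle (root 0F) (root 1F) (root 2F) (root 3F) →
      Linkage (root 0F) (root 2F) (root 1F) (root 3F) → DoubleNegation (RootedK₄ root)
    rooted-K₄ {root} F L = do
      (R , A~C , B~D) ← descend Routed.size step record
        { cycle = F
        ; trailA = begin-trail L.a∈ L.ab
        ; trailB = begin-trail L.c∈ L.cd
        ; trailC = begin-trail L.b∈ (Walk-sym L.ab)
        ; trailD = begin-trail L.d∈ (Walk-sym L.cd)
        ; traceA⊆ = [ a∈ ]-⊆
        ; traceB⊆ = [ b∈ ]-⊆
        ; traceC⊆ = [ c∈ ]-⊆
        ; traceD⊆ = [ d∈ ]-⊆
        }
      return (complete (Routed.cycle R) A~C B~D)
      where
      module L = Linkage L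
      open FourCycle F using (a∈; b∈; c∈; d∈)

      step : (R : Routed L.left L.right (root 0F) (root 1F) (root 2F) (root 3F)) →
        let open Routed in
        DoubleNegation ((Σ[ R′ ∈ Routed L.left L.right _ _ _ _ ] size R′ < size R) ⊎
                        (Σ[ R′ ∈ Routed L.left L.right _ _ _ _ ]
                          Touch (bagA R′) (bagC R′) × Touch (bagB R′) (bagD R′)))
      step R = do
        inj₂ A~C ← chord L.left⊥right R
          where inj₁ (smaller R′ R′<) → return (inj₁ (R′ , R′<))
        inj₂ B~D ← chord (L.left⊥right ∘ swap) (flipR R)
          where inj₁ S → let smaller R′ R′< = flip-smaller S in return (inj₁ (R′ , R′<))
        return (inj₂ (R , A~C , B~D))

    -- The fifth vertex.

    -- `home` stands in for the bag of root `i` and contains `e` as well; `punchIn i` enumerates the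
    -- other three bags.
    record Home {root} (K : RootedK₄ root) (e : V G) (i : Fin 4) : Set where
      open RootedK₄ K
      field
        {home}    : Bag
        home-conn : Conn home
        root∈home : root i ∈ home
        e∈home    : e ∈ home
        apart     : ∀ j → Disjoint home (bag (punchIn i j))
        adjacent  : ∀ j → Touch home (bag (punchIn i j))

    -- If `e` is outside all bags, it is followed along the walk until just before the first bag
    -- met, and the trace is added to that bag. The index found need not be `j`.
    find-home : ∀ {root e j} (K : RootedK₄ root) → S e → Walk S e (root j) →
      DoubleNegation (∃[ i ] Home K e i)
    find-home {e = e} {j} K e∈S w = do
      no e∉K ← decide (∃[ i ] e ∈ bag i)
        where
        yes (i , e∈i) → return (i , record
          { home-conn = conn i
          ; root∈home = root∈bag i
          ; e∈home = e∈i
          ; apart = λ j → disjoint (≢-sym (punchInᵢ≢i i j))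
          ; adjacent = λ j → touch (≢-sym (punchInᵢ≢i i j))
          })
      (r , u , v , u∈ , (i , v∈i) , uv) ← reach {O = λ v → ∃[ i ] v ∈ bag i}
        (j , root∈bag j)
        record { trail = begin-trail e∈S w ; avoids = λ { (here refl , e∈K) → e∉K e∈K } }
      let open Reaching r
      return (i , record
        { home-conn = Conn-++ (conn i) (trace-conn trail) (v , u , v∈i , u∈ , Adj-sym uv)
        ; root∈home = ∈-++⁺ˡ (root∈bag i)
        ; e∈home = ∈-++⁺ʳ (bag i) (root∈ trail)
        ; apart = λ j → Disjoint-++ˡ (bag i) (disjoint (≢-sym (punchInᵢ≢i i j)))
            (λ (v∈t , v∈j) → avoids (v∈t , _ , v∈j))
        ; adjacent = λ j → Touch-++ˡ _ (touch (≢-sym (punchInᵢ≢i i j)))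
        })
      where open RootedK₄ K

    -- The hubs are `L` and bag `l`, the spokes are bags `j` and `k` and `R`. The hub `l` touches
    -- `j` and `k` because all bags of `K` touch each other.
    no-split-bag : ∀ {root} (K : RootedK₄ root) → let open RootedK₄ K in ∀ i {L R} →
      Conn L → Conn R → Disjoint L R → Touch L R →
      (∀ j → Disjoint L (bag (punchIn i j))) → (∀ j → Disjoint R (bag (punchIn i j))) →
      ¬ TwoOne (λ j → Touch L (bag (punchIn i j))) (λ j → Touch R (bag (punchIn i j)))
    no-split-bag K i connL connR LR L~R apartL apartR
      record { j≢k = j≢k ; j≢l = j≢l ; k≢l = k≢l ; Tj = L~j ; Tk = L~k ; T′l = R~l } =
      K₂,₃-free (K₂,₃-minor
        (connL ∷ conn _ ∷ conn _ ∷ conn _ ∷ connR ∷ [])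
        ( (apartL _ ∷ apartL _ ∷ apartL _ ∷ LR ∷ [])
        ∷ (other (≢-sym j≢l) ∷ other (≢-sym k≢l) ∷ Disjoint-sym (apartR _) ∷ [])
        ∷ (other j≢k ∷ Disjoint-sym (apartR _) ∷ [])
        ∷ (Disjoint-sym (apartR _) ∷ [])
        ∷ [] ∷ [])
        (L~j ∷ L~k ∷ L~R ∷ [])
        (touch (≢-sym j≢l ∘ punchIn-injective i _ _) ∷ touch (≢-sym k≢l ∘ punchIn-injective i _ _)
          ∷ Touch-sym R~l ∷ []))
      where
      open RootedK₄ K
      other : ∀ {j k} → j ≢ k → Disjoint (bag (punchIn i j)) (bag (punchIn i k))
      other j≢k = disjoint (j≢k ∘ punchIn-injective i _ _)

    -- The linkage cuts the home of e into two connected parts, each touching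
    -- some other bag; then one part L touches two bags, the other part R the
    -- third one, and L and that third bag are the hubs of a K₂,₃.
    no-fifth : ∀ {root e} → RootedK₄ root →
      ¬ (∀ i → Linkage (root i) (root (punchIn i 0F)) e (root (punchIn i 1F)))
    no-fifth {root} {e} K linkage = contradicted id
      where
      open RootedK₄ K

      contradicted : DoubleNegation _
      contradicted = do
        -- Any of the linkages would do here: only a walk from `e` to some root is wanted. The
        -- linkage that does the cutting is chosen after `i` is known.
        (i , H) ← find-home K (Linkage.c∈ (linkage 0F)) (Linkage.cd (linkage 0F))
        let open Home H
            open Linkage (linkage i)
            other j = bag (punchIn i j)
            Other = λ v → ∃[ j ] v ∈ other j
            avoid : ∀ {v} → v ∈ home → (_∈ [ v ]) ⊥ Other
            avoid = λ { v∈ (here refl , j , v∈j) → apart j (v∈ , v∈j) }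
        (p , u , _ , u∈p , (j , v∈j) , uv) ← reach {O = Other} (0F , root∈bag _)
          record { trail = begin-trail a∈ ab ; avoids = avoid root∈home }
        (q , u′ , _ , u′∈q , (j′ , v∈j′) , uv′) ← reach {O = Other} (1F , root∈bag _)
          record { trail = begin-trail c∈ cd ; avoids = avoid e∈home }
        let module P = Reaching p
            module Q = Reaching q
            tp = trace P.trail
            tq = trace Q.trail
            -- The two paths may leave `home` before they come next to another bag. Their traces are
            -- therefore added to it, and then serve as the seeds of the cut, so that each half
            -- touches another bag.
            hull = (home ++ tp) ++ tq
            hull-apart : ∀ j → Disjoint hull (other j)
            hull-apart = λ j → Disjoint-++ˡ (home ++ tp)
              (Disjoint-++ˡ home (apart j) (λ (v∈ , v∈j) → P.avoids (v∈ , j , v∈j)))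
              (λ (v∈ , v∈j) → Q.avoids (v∈ , j , v∈j))
        halves ← split
          (Conn-overlap (Conn-overlap home-conn (trace-conn P.trail) root∈home (root∈ P.trail))
            (trace-conn Q.trail) (∈-++⁺ˡ e∈home) (root∈ Q.trail))
          (trace-conn P.trail) (trace-conn Q.trail)
          (∈-++⁺ˡ ∘ ∈-++⁺ʳ home) (∈-++⁺ʳ (home ++ tp))
          (Disjoint-traces left⊥right P.trail Q.trail)
        let module H = Split halves
        return (
          [ no-split-bag K i H.left-conn H.right-conn H.disjoint H.touch
              (λ j → Disjoint-⊆ H.left⊆ id (hull-apart j))
              (λ j → Disjoint-⊆ H.right⊆ id (hull-apart j))
          , no-split-bag K i H.right-conn H.left-conn
              (Disjoint-sym H.disjoint) (Touch-sym H.touch)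
              (λ j → Disjoint-⊆ H.right⊆ id (hull-apart j))
              (λ j → Disjoint-⊆ H.left⊆ id (hull-apart j))
          ]′ (two-versus-one
            (λ j → H.touch-side (Touch-⊆ (∈-++⁺ˡ ∘ ∈-++⁺ˡ) id (adjacent j)))
            (j , u , _ , H.⊆left u∈p , v∈j , uv)
            (j′ , u′ , _ , H.⊆right u′∈q , v∈j′ , uv′)))

-- From an agile set to linkages, and the conclusion.

covered-walk : (G : Graph) {X : VertexSet G} {T : Subgraph G} → TreeCovering G X T →
  ∀ {x y} → X x → X y → Bags.Walk G (VS T) x y
covered-walk G {T = T} (inj₁ ((_ , walk) , _) , X⊆T) x∈X y∈X = Star.map
  (λ e → Subgraph.edge⇒∈ T e , Subgraph.edge⇒∈ T (Subgraph.symmetric T e) , Subgraph.edge⇒adj T e)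
  (walk (X⊆T x∈X) (X⊆T y∈X))
covered-walk G (inj₂ (X-empty , _) , _) x∈X _ = contradiction x∈X (X-empty _)

agile-linkage : ∀ {G X n} ((f , _) : HasSize X n) → Agile G X →
  ∀ {i j k l} → k ≢ i → k ≢ j → l ≢ i → l ≢ j → Bags.Linkage G (f i) (f j) (f k) (f l)
agile-linkage {G} {X} (f , f-injective , X⊆f , f⊆X) agile {i} {j} {k} {l} k≢i k≢j l≢i l≢j =
  linkage (agile X₁ X₂ (X⊆X₁∪X₂ , X₁∪X₂⊆X) X₁⊥X₂)
  where
  X₁ X₂ : VertexSet G
  X₁ v = v ≡ f i ⊎ v ≡ f j
  -- The complement is expressed through indices, whose equality is decidable, so that `X₁` and `X₂`
  -- constructively cover `X`.
  X₂ v = ∃[ m ] f m ≡ v × m ≢ i × m ≢ j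

  X⊆X₁∪X₂ : ∀ {v} → X v → X₁ v ⊎ X₂ v
  X⊆X₁∪X₂ v∈X with X⊆f v∈X
  ... | m , refl with m ≟ᶠ i | m ≟ᶠ j
  ...   | yes refl | _        = inj₁ (inj₁ refl)
  ...   | no _     | yes refl = inj₁ (inj₂ refl)
  ...   | no m≢i   | no m≢j   = inj₂ (m , refl , m≢i , m≢j)

  X₁∪X₂⊆X : ∀ {v} → X₁ v ⊎ X₂ v → X v
  X₁∪X₂⊆X (inj₁ (inj₁ refl))   = f⊆X (i , refl)
  X₁∪X₂⊆X (inj₁ (inj₂ refl))   = f⊆X (j , refl)
  X₁∪X₂⊆X (inj₂ (m , fm≡v , _)) = f⊆X (m , fm≡v)

  X₁⊥X₂ : X₁ ⊥ X₂
  X₁⊥X₂ (inj₁ refl , m , fm≡fi , m≢i , _) = m≢i (f-injective fm≡fi)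
  X₁⊥X₂ (inj₂ refl , m , fm≡fj , _ , m≢j) = m≢j (f-injective fm≡fj)

  linkage : Independent G X₁ X₂ → Bags.Linkage G (f i) (f j) (f k) (f l)
  linkage (T₁ , T₂ , cover₁ , cover₂ , T₁⊥T₂) = record
    { left⊥right = T₁⊥T₂
    ; a∈ = proj₂ cover₁ (inj₁ refl)
    ; b∈ = proj₂ cover₁ (inj₂ refl)
    ; c∈ = proj₂ cover₂ k∈X₂
    ; d∈ = proj₂ cover₂ l∈X₂
    ; ab = covered-walk G cover₁ (inj₁ refl) (inj₂ refl)
    ; cd = covered-walk G cover₂ k∈X₂ l∈X₂
    }
    where
    k∈X₂ : X₂ (f k)
    k∈X₂ = k , refl , k≢i , k≢j
    l∈X₂ : X₂ (f l)
    l∈X₂ = l , refl , l≢i , l≢j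

proposition3p1 : ∀ (G : Graph) → ¬ IsMinor (CompleteBipartite 2 3) G →
    ¬ (∃[ X ] HasSize X 5 × Agile G X)
proposition3p1 G K₂,₃-free (X , size@(f , _) , agile) = refuted id
  where
  open Bags G

  link : ∀ {i j k l} → k ≢ i → k ≢ j → l ≢ i → l ≢ j → Linkage (f i) (f j) (f k) (f l)
  link = agile-linkage {X = X} size agile

  -- `inject₁` picks out the four roots among the five vertices, and the last index `fromℕ 4` is
  -- that of `e`.
  fifth-link : ∀ i → Linkage (f (inject₁ i)) (f (inject₁ (punchIn i 0F)))
                             (f (fromℕ 4)) (f (inject₁ (punchIn i 1F)))
  fifth-link i = link fromℕ≢inject₁ fromℕ≢inject₁ (punchInᵢ≢i i 1F ∘ inject₁-injective)
    (λ eq → contradiction (punchIn-injective i 1F 0F (inject₁-injective eq)) (λ ()))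

  refuted : DoubleNegation _
  refuted = do
    -- The linkages are ab|cd and ad|cb, written so that all four walks start at `a` or `c`.
    cycle ← four-cycle (link {0F} {1F} {2F} {3F} (λ ()) (λ ()) (λ ()) (λ ()))
                       (link {0F} {3F} {2F} {1F} (λ ()) (λ ()) (λ ()) (λ ()))
    K₄ ← rooted-K₄ K₂,₃-free {root = f ∘ inject₁} cycle
      (link {0F} {2F} {1F} {3F} (λ ()) (λ ()) (λ ()) (λ ()))
    return (no-fifth K₂,₃-free K₄ fifth-link)
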